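{- For every integer $m \geq 1$, there exist infinitely many $\{0,m\}$-perfect numbers.
   Context: Let $\mathcal{S} \subset \mathbb{Z}$. An integer $n > 1$ with positive divisors $1 = d_0 < d_1 < \cdots < d_r < d_{r+1} = n$ is called $\mathcal{S}$-perfect (of the first kind) if there exist $\lambda_1, \ldots, \lambda_r \in \mathcal{S}$ (not necessarily distinct) such that $1+\sum_{j=1}^{r}\lambda_j d_j = n$. (The divisor $1$ always has coefficient $1$, and every divisor $d$ with $1<d<n$ must receive a coefficient from $\mathcal{S}$.) -}

module Defs where

open import Data.Fin.Base using (Fin)
open import Data.Integer.Base using (ℤ; +_; 0ℤ; 1ℤ; _+_; _*_)
open import Data.Integer.Properties using (+-0-commutativeMonoid)
open import Data.List.Base using (List; filter; length; lookup; upTo)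
open import Data.Nat.Base using (ℕ; _<_)
open import Data.Nat.Divisibility using (_∣?_)
open import Data.Nat.Properties using (_<?_)
open import Data.Product.Base using (Σ-syntax; ∃-syntax; _×_)
open import Level using (Level)
open import Relation.Binary.PropositionalEquality.Core using (_≡_)
open import Relation.Nullary.Decidable using (_×-dec_)
open import Relation.Unary using (Pred; ｛_｝; _∪_)

open import Algebra.Properties.CommutativeMonoid.Sum +-0-commutativeMonoid
  using (sum-syntax)

private
  variable
    ℓ : Level

-- d₁ < ⋯ < dᵣ in increasing order; `upTo n` is [0, …, n - 1], so n itself
-- is left out.
intermediateDivisors : ℕ → List ℕ
intermediateDivisors n = filter (λ d → (1 <? d) ×-dec (d ∣? n)) (upTo n)

infix 4 _-Perfect_

_-Perfect_ : Pred ℤ ℓ → ℕ → Set ℓ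
S -Perfect n =
  let ds = intermediateDivisors n
      r  = length ds
  in 1 < n ×
     (Σ[ c ∈ (Fin r → ℤ) ]
       (∀ j → S (c j)) ×
       1ℤ + (∑[ j < r ] (c j * + lookup ds j)) ≡ + n)

｛0,_｝ : ℕ → Pred ℤ _
｛0, m ｝ = ｛ 0ℤ ｝ ∪ ｛ + m ｝

-- Infinite in the sense of unbounded.  This is constructively stronger than
-- `Inf` from `Data.Nat.InfinitelyOften`, which yields no witnesses.
InfinitelyMany : Pred ℕ ℓ → Set ℓ
InfinitelyMany P = ∀ N → ∃[ n ] N < n × P n

{-# OPTIONS --safe #-}
-- With a = m + 1 and b = m² + m + 1, the product n = a b equals 1 + m (a + b),
-- which is {0,m}-perfect.  If n = 1 + m s with s a sum of distinct divisors of
-- n strictly between 1 and n, then n (m + 1) = 1 + m (s + n), and n is a new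
-- intermediate divisor of n (m + 1), so multiplying by m + 1 can be repeated.
module Submission where

open import Defs
open import Data.Integer.Base as ℤ using (ℤ; +_; 0ℤ; 1ℤ)
import Data.Integer.Properties as ℤ
open import Algebra.Properties.CommutativeMonoid.Sum ℤ.+-0-commutativeMonoid
  using (sum-syntax)
open import Data.List.Base using (List; []; _∷_; filter; length; lookup)
open import Data.List.Membership.Propositional using (_∈_)
open import Data.List.Membership.Propositional.Properties
  using (∈-filter⁺; ∈-filter⁻; ∈-upTo⁺)
open import Data.List.Membership.Propositional.Properties.WithK using (unique∧set⇒bag)
open import Data.List.Relation.Binary.BagAndSetEquality using (∼bag⇒↭)
open import Data.List.Relation.Binary.Permutation.Propositional using (_↭_)
open import Data.List.Relation.Unary.All as All using (All; []; _∷_)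
open import Data.List.Relation.Unary.AllPairs using ([]; _∷_)
open import Data.List.Relation.Unary.Unique.Propositional using (Unique)
open import Data.List.Relation.Unary.Unique.Propositional.Properties using (filter⁺; upTo⁺)
open import Data.Nat.Base using (ℕ; zero; suc; _+_; _*_; _≤_; _<_; s≤s; z<s; s<s; >-nonZero)
open import Data.Nat.Divisibility using (_∣_; m∣m*n; n∣m*n; ∣m⇒∣m*n)
open import Data.Nat.ListAction using (sum)
open import Data.Nat.ListAction.Properties using (sum-↭)
open import Data.Nat.Properties
  using (_≟_; *-distribˡ-+; *-zeroʳ; *-comm; *-suc; ≤-<-trans; <-trans; <⇒≢; >⇒≢;
         m<m*n; m<m+n; *-mono-≤)
open import Data.List.Membership.DecPropositional _≟_ using (_∈?_)
open import Data.Nat.Solver using (module +-*-Solver)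
open import Data.Product.Base using (_×_; _,_; proj₂)
open import Data.Sum.Base using (inj₁; inj₂)
open import Function.Base using (_∘_)
open import Function.Bundles using (mk⇔)
open import Level using (Level)
open import Relation.Binary.PropositionalEquality
  using (_≡_; refl; sym; trans; cong; cong₂; subst; module ≡-Reasoning)
open import Relation.Nullary.Decidable using (yes; no)
open import Relation.Unary using (Pred; Decidable)

private
  variable
    p : Level
    d m n : ℕ
    xs ys : List ℕ

-- Two duplicate-free lists with the same members are equal as bags, hence permutations of each
-- other. So a sum over a freely ordered selection can be compared with a sum over the list it is
-- selected from.
filter-∈-↭ : Unique xs → Unique ys → All (_∈ ys) xs → filter (_∈? xs) ys ↭ xs
filter-∈-↭ {xs} {ys} xs! ys! xs⊆ys =
  ∼bag⇒↭ (unique∧set⇒bag (filter⁺ _ ys!) xs!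
    (mk⇔ (proj₂ ∘ ∈-filter⁻ _ {xs = ys}) (λ x∈xs → ∈-filter⁺ _ (All.lookup xs⊆ys x∈xs) x∈xs)))

module _ {P : Pred ℕ p} (P? : Decidable P) (m : ℕ) where

  coefficient : ℕ → ℤ
  coefficient d with P? d
  ... | yes _ = + m
  ... | no  _ = 0ℤ

  coefficient∈｛0,m｝ : ∀ d → ｛0, m ｝ (coefficient d)
  coefficient∈｛0,m｝ d with P? d
  ... | yes _ = inj₂ refl
  ... | no  _ = inj₁ refl

  ∑-coefficient : ∀ ds →
    (∑[ j < length ds ] (coefficient (lookup ds j) ℤ.* + lookup ds j)) ≡
    + (m * sum (filter P? ds))
  ∑-coefficient []       = cong +_ (sym (*-zeroʳ m))
  ∑-coefficient (d ∷ ds) with P? d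
  -- The head term `0ℤ ℤ.* + d` computes to `0ℤ`, so only a left identity has to be removed.
  ... | no  _ = trans (ℤ.+-identityˡ _) (∑-coefficient ds)
  ... | yes _ = begin
    + m ℤ.* + d ℤ.+ _                  ≡⟨ cong₂ ℤ._+_ (sym (ℤ.pos-* m d)) (∑-coefficient ds) ⟩
    + (m * d + m * sum (filter P? ds)) ≡⟨ cong +_ (*-distribˡ-+ m d _) ⟨
    + (m * (d + sum (filter P? ds)))   ∎
    where open ≡-Reasoning

IntermediateDivisor : ℕ → ℕ → Set
IntermediateDivisor n d = 1 < d × d ∣ n × d < n

∈-intermediateDivisors : IntermediateDivisor n d → d ∈ intermediateDivisors n
∈-intermediateDivisors (1<d , d∣n , d<n) = ∈-filter⁺ _ (∈-upTo⁺ d<n) (1<d , d∣n)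

-- Only the divisors with coefficient `m` are kept, in any order and within ℕ. Coefficients indexed
-- by positions in `intermediateDivisors n` would need reindexing when `n` changes, whereas this
-- list is simply extended.
record Representation (m n : ℕ) : Set where
  field
    1<n      : 1 < n
    divisors : List ℕ
    unique   : Unique divisors
    proper   : All (IntermediateDivisor n) divisors
    1+m*sum  : 1 + m * sum divisors ≡ n

open Representation

-- Listed divisors receive `m`, the other intermediate divisors `0ℤ`. The chosen divisors may come
-- in two different orders, which their sum does not see.
representation⇒perfect : Representation m n → ｛0, m ｝ -Perfect n
representation⇒perfect {m} {n} R =
  1<n R ,
  (λ j → coefficient P? m (lookup ds j)) ,
  (λ j → coefficient∈｛0,m｝ P? m (lookup ds j)) ,
  (begin
    1ℤ ℤ.+ (∑[ j < length ds ] (coefficient P? m (lookup ds j) ℤ.* + lookup ds j))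
      ≡⟨ cong (ℤ._+_ 1ℤ) (∑-coefficient P? m ds) ⟩
    + (1 + m * sum (filter P? ds))
      ≡⟨ cong (λ s → + (1 + m * s)) (sum-↭ chosen) ⟩
    + (1 + m * sum (divisors R))
      ≡⟨ cong +_ (1+m*sum R) ⟩
    + n ∎)
  where
  open ≡-Reasoning
  ds = intermediateDivisors n
  P? = _∈? divisors R
  chosen : filter P? ds ↭ divisors R
  chosen = filter-∈-↭ (unique R) (filter⁺ _ (upTo⁺ n)) (All.map ∈-intermediateDivisors (proper R))

module _ (1≤m : 1 ≤ m) where

  n<n*[1+m] : 1 < n → n < n * suc m
  n<n*[1+m] {n} 1<n = m<m*n n (suc m) {{>-nonZero (<-trans z<s 1<n)}} (s≤s 1≤m)

  -- The equation 1 + m (a + b) = a b amounts to (a - m) (b - m) = m² + 1. The trivial factorisation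
  -- 1 · (m² + 1) yields these values of a and b.
  representation-[1+m]*[1+m+m*m] : Representation m (suc m * suc (m + m * m))
  representation-[1+m]*[1+m+m*m] = record
    { 1<n      = <-trans 1<a a<ab
    ; divisors = suc m ∷ suc (m + m * m) ∷ []
    ; unique   = (<⇒≢ a<b ∷ []) ∷ [] ∷ []
    ; proper   = (1<a , m∣m*n _ , a<ab) ∷ (<-trans 1<a a<b , n∣m*n (suc m) , b<ab) ∷ []
    -- The final `con 0` is the `sum` of the empty tail, and each `con 1 :+` spells out a `suc`.
    ; 1+m*sum  = solve 1 (λ m → con 1 :+ m :* (con 1 :+ m :+ (con 1 :+ (m :+ m :* m) :+ con 0)) :=
                                (con 1 :+ m) :* (con 1 :+ (m :+ m :* m))) refl m
    }
    where
    open +-*-Solver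
    1<a : 1 < suc m
    1<a = s≤s 1≤m
    a<b : suc m < suc (m + m * m)
    a<b = s<s (m<m+n m (*-mono-≤ 1≤m 1≤m))
    a<ab : suc m < suc m * suc (m + m * m)
    a<ab = m<m*n (suc m) _ (<-trans 1<a a<b)
    b<ab : suc (m + m * m) < suc m * suc (m + m * m)
    b<ab = subst (suc (m + m * m) <_) (*-comm (suc (m + m * m)) (suc m)) (n<n*[1+m] (<-trans 1<a a<b))

  representation-*[1+m] : Representation m n → Representation m (n * suc m)
  representation-*[1+m] {n} R = record
    { 1<n      = <-trans (1<n R) n<n′
    ; divisors = n ∷ divisors R
    -- Every earlier divisor is strictly below `n`, so `n` is not among them.
    ; unique   = All.map (λ { (_ , _ , d<n) → >⇒≢ d<n }) (proper R) ∷ unique R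
    ; proper   = (1<n R , m∣m*n (suc m) , n<n′) ∷
                 All.map (λ { (1<d , d∣n , d<n) → 1<d , ∣m⇒∣m*n (suc m) d∣n , <-trans d<n n<n′ }) (proper R)
    ; 1+m*sum  = begin
        1 + m * (n + s)     ≡⟨ solve 3 (λ m n s → con 1 :+ m :* (n :+ s) := con 1 :+ m :* s :+ n :* m) refl m n s ⟩
        1 + m * s + n * m   ≡⟨ cong (_+ n * m) (1+m*sum R) ⟩
        n + n * m           ≡⟨ *-suc n m ⟨
        n * suc m           ∎
    }
    where
    open ≡-Reasoning
    open +-*-Solver
    s = sum (divisors R)
    n<n′ = n<n*[1+m] (1<n R)

  -- Induction on the bound: each multiplication by `suc m` strictly enlarges the number, so it
  -- passes at least one more bound.
  infinitelyManyRepresentations : InfinitelyMany (Representation m)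
  infinitelyManyRepresentations zero    = _ , <-trans z<s (1<n R) , R
    where R = representation-[1+m]*[1+m+m*m]
  infinitelyManyRepresentations (suc N) with infinitelyManyRepresentations N
  -- `N<n` is read as `suc N ≤ n`, which the strict growth turns into `suc N < n * suc m`.
  ... | n , N<n , R = n * suc m , ≤-<-trans N<n (n<n*[1+m] (1<n R)) , representation-*[1+m] R

theorem6 : ∀ (m : ℕ) → 1 ≤ m → InfinitelyMany (λ n → ｛0, m ｝ -Perfect n)
theorem6 m 1≤m N with infinitelyManyRepresentations 1≤m N
... | n , N<n , R = n , N<n , representation⇒perfect R
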